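{- Let $k\ge 1$ and $n$ be integers with $2k\le n\le 2k+2$ (equivalently, $\mathrm{SG}(n,k)$ is $t$-chromatic with $t=n-2k+2\le 4$). Then $\mathrm{SG}(n,k)$ admits an orientation in which every shortest odd cycle of $\mathrm{SG}(n,k)$ is alternating (vacuously if it has no odd cycle).
   Context: The Kneser graph $\mathrm{KG}(n,k)$ ($n\ge 2k$) has as vertices all $k$-element subsets of $[n]=\{1,\dots,n\}$, two being adjacent iff disjoint. The Schrijver graph $\mathrm{SG}(n,k)$ is the induced subgraph of $\mathrm{KG}(n,k)$ on the stable $k$-subsets, i.e., those $A$ containing no pair $\{i,i+1\}$ for $i\in[n-1]$ and not containing both $1$ and $n$; its chromatic number is $n-2k+2$. An orientation assigns each edge exactly one direction. In an oriented graph, a subgraph that is a cycle is called alternating if at most one of its vertices has both positive in-degree and positive out-degree within that cycle. -}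

module Defs where

open import Data.Nat using (ℕ; suc; _≤_; _%_; NonZero; ≢-nonZero⁻¹)
import Data.Nat.Properties as ℕₚ
open import Data.Fin using (Fin; toℕ)
open import Data.Fin.Subset using (Subset; _∈_; _∩_; Empty; ∣_∣)
open import Data.Fin.Subset.Properties using (∩-comm; ∩-idem; Empty-unique; ∣⊥∣≡0)
open import Data.Product using (∃-syntax; _×_)
open import Data.Sum using (_⊎_)
open import Function.Definitions using (Injective)
open import Relation.Binary.Definitions using (Symmetric)
open import Relation.Nullary using (¬_)
open import Relation.Nullary.Decidable using (recompute)
open import Relation.Binary.PropositionalEquality using (_≡_; refl; sym; trans; cong; subst)

record Graph : Set₁ where
  field
    Vertex   : Set
    _~_      : Vertex → Vertex → Set
    ~-sym    : Symmetric _~_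
    ~-irrefl : ∀ v → ¬ (v ~ v)

-- Membership proofs are irrelevant, so that two vertices of an induced
-- subgraph are equal as soon as they are equal in the ambient graph.
record InducedVertex (G : Graph) (P : Graph.Vertex G → Set) : Set where
  constructor _!_
  field
    vertex : Graph.Vertex G
    .holds : P vertex

induced : (G : Graph) → (Graph.Vertex G → Set) → Graph
induced G P = record
  { Vertex   = InducedVertex G P
  ; _~_      = λ u v → InducedVertex.vertex u ~ InducedVertex.vertex v
  ; ~-sym    = ~-sym
  ; ~-irrefl = λ v → ~-irrefl (InducedVertex.vertex v)
  }
  where open Graph G

-- The ground set [n] = {1,…,n} is Fin n, the element i being the index
-- with toℕ equal to i - 1.
record KSubset (n k : ℕ) : Set where
  constructor _!_
  field
    set   : Subset n
    .size : ∣ set ∣ ≡ k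

-- k ≠ 0 is needed for looplessness: the empty set is disjoint from itself.
KG : (n k : ℕ) .{{_ : NonZero k}} → Graph
KG n k = record
  { Vertex   = KSubset n k
  ; _~_      = λ A B → Empty (KSubset.set A ∩ KSubset.set B)
  ; ~-sym    = λ {A} {B} → subst Empty (∩-comm (KSubset.set A) (KSubset.set B))
  ; ~-irrefl = irrefl
  }
  where
  irrefl : (A : KSubset n k) → ¬ Empty (KSubset.set A ∩ KSubset.set A)
  irrefl (A ! ∣A∣≡k) e = ≢-nonZero⁻¹ k
    (trans (sym (recompute (∣ A ∣ ℕₚ.≟ k) ∣A∣≡k))
    (trans (cong ∣_∣ (Empty-unique (subst Empty (∩-idem A) e))) (∣⊥∣≡0 n)))

-- Successor in the cyclic order 0, 1, …, m - 1, 0 on indices.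
data CyclicSucc {m : ℕ} (i j : Fin m) : Set where
  step : toℕ j ≡ suc (toℕ i) → CyclicSucc i j
  wrap : suc (toℕ i) ≡ m → toℕ j ≡ 0 → CyclicSucc i j

-- step excludes the pairs {i, i+1} with i ∈ [n-1]; wrap excludes {n, 1}.
Stable : ∀ {n} → Subset n → Set
Stable A = ∀ i j → CyclicSucc i j → ¬ (i ∈ A × j ∈ A)

SG : (n k : ℕ) .{{_ : NonZero k}} → Graph
SG n k = induced (KG n k) (λ A → Stable (KSubset.set A))

record Orientation (G : Graph) : Set₁ where
  open Graph G
  field
    _⟶_      : Vertex → Vertex → Set
    ⟶-edge   : ∀ {u v} → u ⟶ v → u ~ v
    ⟶-total  : ∀ {u v} → u ~ v → u ⟶ v ⊎ v ⟶ u
    ⟶-asym   : ∀ {u v} → u ⟶ v → ¬ (v ⟶ u)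

record Cycle (G : Graph) (m : ℕ) : Set where
  open Graph G
  field
    length≥3  : 3 ≤ m
    at        : Fin m → Vertex
    injective : Injective _≡_ _≡_ at
    edge      : ∀ {i j} → CyclicSucc i j → at i ~ at j

CycleNeighbours : ∀ {m} → Fin m → Fin m → Set
CycleNeighbours i j = CyclicSucc i j ⊎ CyclicSucc j i

module _ {G : Graph} (O : Orientation G) {m : ℕ} (C : Cycle G m) where
  open Orientation O
  open Cycle C

  PositiveInDegree : Fin m → Set
  PositiveInDegree i = ∃[ j ] (CycleNeighbours i j × at j ⟶ at i)

  PositiveOutDegree : Fin m → Set
  PositiveOutDegree i = ∃[ j ] (CycleNeighbours i j × at i ⟶ at j)

  Alternating : Set
  Alternating = ∀ i j → PositiveInDegree i × PositiveOutDegree i →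
                        PositiveInDegree j × PositiveOutDegree j → i ≡ j

Odd : ℕ → Set
Odd m = m % 2 ≡ 1

-- Being a shortest odd cycle depends only on the length of the cycle.
ShortestOdd : ∀ {G m} → Cycle G m → Set
ShortestOdd {G} {m} _ = Odd m × (∀ m′ → Odd m′ → Cycle G m′ → m ≤ m′)

{-# OPTIONS --safe #-}
module Submission where

-- Orient every edge away from sets containing 0 and towards sets containing 1;
-- this is consistent because no stable set contains both, and the remaining
-- edges are oriented arbitrarily.
--
-- In an odd cycle A₁, …, Aₘ call an edge AᵢAᵢ₊₁ a gap of the element e when e lies
-- in neither end. The number of gaps of e is m minus twice the number of sets
-- containing e, so it is odd, and the gap numbers add up to (n − 2k) m. If 0
-- has only one gap, then all other edges of the cycle point away from the sets
-- containing 0, so that the cycle is alternating; likewise for 1. Otherwise 0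
-- and 1 have at least three gaps each, hence (n − 2k) m ≥ n + 4, which is too
-- long: SG(2k + 1, k) has an odd cycle of length 2k + 1, and SG(2k + 2, k) one
-- of length k + 1 or k + 2. The latter is obtained, for k = a + b with
-- b ∈ {a, a + 1}, by concatenating stable sets of SG(2a + 1, a) and SG(2b + 1, b).

open import Data.Bool using (Bool; true; false; not; _∧_)
import Data.Bool as Bool
import Data.Bool.Properties as Boolₚ
open import Data.Empty using (⊥; ⊥-elim; ⊥-elim-irr)
open import Data.Fin using (Fin; zero; suc; toℕ; fromℕ; inject₁)
import Data.Fin.Properties as Finₚ
open import Data.Fin.Relation.Unary.Top using (view; ‵fromℕ; ‵inj₁; view-fromℕ; view-inject₁)
open import Data.Fin.Subset using (Subset; ∣_∣; Empty; _∩_; _∈_)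
open import Data.Fin.Subset.Properties using (x∈p∩q⁺; x∈p∩q⁻)
open import Data.Nat using (ℕ; zero; suc; _+_; _*_; _≤_; _<_; _∸_; _%_; z≤n; s≤s; NonZero; >-nonZero⁻¹)
open import Data.Nat.DivMod using ([m+kn]%n≡m%n)
import Data.Nat.Properties as ℕₚ
open import Data.Nat.Tactic.RingSolver using (solve-∀)
open import Data.Product using (Σ-syntax; ∃-syntax; _×_; _,_; proj₁; proj₂; swap)
open import Data.Sum using (_⊎_; inj₁; inj₂)
open import Data.Vec using (Vec; []; _∷_; lookup)
open import Data.Vec.Properties using (∷-injective; lookup⇒[]=; []=⇒lookup)
import Data.Vec.Relation.Binary.Lex.Strict as Lex
open import Data.Vec.Relation.Binary.Pointwise.Inductive using (Pointwise-≡⇒≡)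
open import Function using (_∘_; case_of_)
open import Function.Definitions using (Injective)
open import Relation.Binary.Definitions using (tri<; tri≈; tri>)
open import Relation.Binary.PropositionalEquality
open import Relation.Nullary using (¬_)
open import Relation.Nullary.Decidable using (recompute)
open import Algebra.Properties.CommutativeMonoid.Sum ℕₚ.+-0-commutativeMonoid
  using (sum; sum-cong-≗; sum-init-last; ∑-distrib-+; ∑-comm)
open import Defs

-- Gaps of a cyclic binary sequence

χ : Bool → ℕ
χ false = 0
χ true  = 1

sum-const : ∀ n c → sum {n} (λ _ → c) ≡ n * c
sum-const zero    c = refl
sum-const (suc n) c = cong (c +_) (sum-const n c)

n≤sum : ∀ {n} (f : Fin n → ℕ) → (∀ i → 1 ≤ f i) → n ≤ sum f
n≤sum {zero}  f 1≤f = z≤n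
n≤sum {suc n} f 1≤f = ℕₚ.+-mono-≤ (1≤f zero) (n≤sum (f ∘ suc) (1≤f ∘ suc))

χ≤sum : ∀ {n} (p : Fin n → Bool) {i} → p i ≡ true → 1 ≤ sum (χ ∘ p)
χ≤sum p {zero}  pi rewrite pi = s≤s z≤n
χ≤sum p {suc i} pi = ℕₚ.m≤n⇒m≤o+n (χ (p zero)) (χ≤sum (p ∘ suc) pi)

sum≤1⇒unique : ∀ {n} (p : Fin n → Bool) → sum (χ ∘ p) ≤ 1 →
               ∀ {i j} → p i ≡ true → p j ≡ true → i ≡ j
sum≤1⇒unique p ≤1 {zero}  {zero}  pi pj = refl
sum≤1⇒unique p ≤1 {zero}  {suc j} pi pj rewrite pi
  with () ← ℕₚ.≤-trans (χ≤sum (p ∘ suc) pj) (ℕₚ.≤-pred ≤1)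
sum≤1⇒unique p ≤1 {suc i} {zero}  pi pj rewrite pj
  with () ← ℕₚ.≤-trans (χ≤sum (p ∘ suc) pi) (ℕₚ.≤-pred ≤1)
sum≤1⇒unique p ≤1 {suc i} {suc j} pi pj =
  cong suc (sum≤1⇒unique (p ∘ suc) (ℕₚ.≤-trans (ℕₚ.m≤n+m _ (χ (p zero))) ≤1) pi pj)

next : ∀ {m} → Fin (suc m) → Fin (suc m)
next i with view i
... | ‵fromℕ          = zero
... | ‵inj₁ {i = j} _ = suc j

next-fromℕ : ∀ m → next (fromℕ m) ≡ zero
next-fromℕ m rewrite view-fromℕ m = refl

next-inject₁ : ∀ {m} (i : Fin m) → next (inject₁ i) ≡ suc i
next-inject₁ i rewrite view-inject₁ i = refl

CyclicSucc-next : ∀ {m} (i : Fin (suc m)) → CyclicSucc i (next i)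
CyclicSucc-next i with view i
... | ‵fromℕ          = wrap (cong suc (Finₚ.toℕ-fromℕ _)) refl
... | ‵inj₁ {i = j} _ = step (cong suc (sym (Finₚ.toℕ-inject₁ j)))

CyclicSucc⇒≡next : ∀ {m} {i j : Fin (suc m)} → CyclicSucc i j → j ≡ next i
CyclicSucc⇒≡next {i = i} _ with CyclicSucc-next i
CyclicSucc⇒≡next (step p)   | step q   = Finₚ.toℕ-injective (trans p (sym q))
CyclicSucc⇒≡next (step p)   | wrap q _ = ⊥-elim (ℕₚ.<-irrefl (trans p q) (Finₚ.toℕ<n _))
CyclicSucc⇒≡next (wrap p _) | step q   = ⊥-elim (ℕₚ.<-irrefl (trans q p) (Finₚ.toℕ<n _))
CyclicSucc⇒≡next (wrap _ p) | wrap _ q = Finₚ.toℕ-injective (trans p (sym q))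

-- `next` only permutes the indices: the last one goes to 0, every other one to its successor.
sum-next : ∀ {m} (f : Fin (suc m) → ℕ) → sum (f ∘ next) ≡ sum f
sum-next {m} f = begin
  sum (f ∘ next)                                ≡⟨ sum-init-last (f ∘ next) ⟩
  sum (f ∘ next ∘ inject₁) + f (next (fromℕ m)) ≡⟨ cong₂ _+_ (sum-cong-≗ (cong f ∘ next-inject₁)) (cong f (next-fromℕ m)) ⟩
  sum (f ∘ suc) + f zero                        ≡⟨ ℕₚ.+-comm _ (f zero) ⟩
  sum f                                         ∎
  where open ≡-Reasoning

isGap : ∀ {m} → (Fin (suc m) → Bool) → Fin (suc m) → Bool
isGap b i = not (b i) ∧ not (b (next i))

gaps : ∀ {m} → (Fin (suc m) → Bool) → ℕ
gaps b = sum (χ ∘ isGap b)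

isGap-intro : ∀ {m} (b : Fin (suc m) → Bool) {i j} → CyclicSucc i j → b i ≡ false → b j ≡ false → isGap b i ≡ true
isGap-intro b {i} s bi bj with refl ← CyclicSucc⇒≡next s rewrite bi | bj = refl

NoConsecutive : ∀ {m} → (Fin (suc m) → Bool) → Set
NoConsecutive b = ∀ i → b i ≡ true → b (next i) ≡ true → ⊥

-- Each cyclic edge either is a gap or has exactly one end where `b` holds. Summed over the edges,
-- every such position counts twice, once as tail and once as head.
gaps+2*ones≡length : ∀ {m} (b : Fin (suc m) → Bool) → NoConsecutive b → gaps b + 2 * sum (χ ∘ b) ≡ suc m
gaps+2*ones≡length {m} b nc = begin
  gaps b + 2 * sum (χ ∘ b)
    ≡⟨ cong (λ s → gaps b + (sum (χ ∘ b) + s)) (ℕₚ.+-identityʳ _) ⟩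
  gaps b + (sum (χ ∘ b) + sum (χ ∘ b))
    ≡⟨ cong (λ s → gaps b + (sum (χ ∘ b) + s)) (sum-next (χ ∘ b)) ⟨
  gaps b + (sum (χ ∘ b) + sum (χ ∘ b ∘ next))
    ≡⟨ cong (gaps b +_) (∑-distrib-+ (χ ∘ b) (χ ∘ b ∘ next)) ⟨
  gaps b + sum (λ i → χ (b i) + χ (b (next i)))
    ≡⟨ ∑-distrib-+ (χ ∘ isGap b) (λ i → χ (b i) + χ (b (next i))) ⟨
  sum (λ i → χ (isGap b i) + (χ (b i) + χ (b (next i))))
    ≡⟨ sum-cong-≗ (λ i → one (b i) (b (next i)) (nc i)) ⟩
  sum {suc m} (λ _ → 1)
    ≡⟨ sum-const (suc m) 1 ⟩
  suc m * 1
    ≡⟨ ℕₚ.*-identityʳ _ ⟩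
  suc m ∎
  where
  open ≡-Reasoning
  one : ∀ x y → (x ≡ true → y ≡ true → ⊥) → χ (not x ∧ not y) + (χ x + χ y) ≡ 1
  one false false _ = refl
  one false true  _ = refl
  one true  false _ = refl
  one true  true  ¬both = ⊥-elim (¬both refl refl)

gaps-odd : ∀ {m} (b : Fin (suc m) → Bool) → NoConsecutive b → Odd (suc m) → Odd (gaps b)
gaps-odd {m} b nc odd = begin
  gaps b % 2                          ≡⟨ [m+kn]%n≡m%n (gaps b) (sum (χ ∘ b)) 2 ⟨
  (gaps b + sum (χ ∘ b) * 2) % 2      ≡⟨ cong (λ s → (gaps b + s) % 2) (ℕₚ.*-comm (sum (χ ∘ b)) 2) ⟩
  (gaps b + 2 * sum (χ ∘ b)) % 2      ≡⟨ cong (_% 2) (gaps+2*ones≡length b nc) ⟩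
  suc m % 2                           ≡⟨ odd ⟩
  1                                   ∎
  where open ≡-Reasoning

odd⇒≥1 : ∀ {u} → Odd u → 1 ≤ u
odd⇒≥1 {suc u} _ = s≤s z≤n

odd⇒≤1⊎≥3 : ∀ u → Odd u → u ≤ 1 ⊎ 3 ≤ u
odd⇒≤1⊎≥3 1                   _ = inj₁ ℕₚ.≤-refl
odd⇒≤1⊎≥3 (suc (suc (suc u))) _ = inj₂ (s≤s (s≤s (s≤s z≤n)))

-- Alternating cycles from a cut

reverse : ∀ {G} → Orientation G → Orientation G
reverse {G} O = record
  { _⟶_     = λ u v → v ⟶ u
  ; ⟶-edge  = ~-sym ∘ ⟶-edge
  ; ⟶-total = ⟶-total ∘ ~-sym
  ; ⟶-asym  = ⟶-asym
  }
  where
  open Graph G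
  open Orientation O

module _ {G : Graph} (O : Orientation G) (P : Graph.Vertex G → Bool) where
  open Graph G
  open Orientation O

  Sources : Set
  Sources = ∀ {u v} → u ~ v → P u ≡ true → u ⟶ v

  -- A vertex of the cycle with both degrees positive is the tail of an edge
  -- avoiding P, and there is only one such edge.
  sources⇒alternating : Sources → ∀ {m} (C : Cycle G (suc m)) → gaps (P ∘ Cycle.at C) ≤ 1 → Alternating O C
  sources⇒alternating src {m} C ≤1 i j ((i′ , _ , i′⟶i) , (k , ik , i⟶k)) ((j′ , _ , j′⟶j) , (l , jl , j⟶l)) =
    conclude ik jl
    where
    open Cycle C
    b = P ∘ at

    notSource : ∀ {u v} → u ⟶ v → P v ≡ false
    notSource {u} {v} u⟶v with P v in Pv
    ... | true  = ⊥-elim (⟶-asym u⟶v (src (~-sym (⟶-edge u⟶v)) Pv))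
    ... | false = refl

    unique : ∀ {x y} → isGap b x ≡ true → isGap b y ≡ true → x ≡ y
    unique = sum≤1⇒unique (isGap b) ≤1

    bi = notSource i′⟶i
    bj = notSource j′⟶j
    bk = notSource i⟶k
    bl = notSource j⟶l

    conclude : CycleNeighbours i k → CycleNeighbours j l → i ≡ j
    conclude (inj₁ s) (inj₁ t) = unique (isGap-intro b s bi bk) (isGap-intro b t bj bl)
    conclude (inj₂ s) (inj₂ t) with refl ← unique (isGap-intro b s bk bi) (isGap-intro b t bl bj) =
      trans (CyclicSucc⇒≡next s) (sym (CyclicSucc⇒≡next t))
    -- In the mixed cases `i` and `j` would be the two ends of the single gap, which would then be
    -- oriented both ways.
    conclude (inj₁ s) (inj₂ t) with refl ← unique (isGap-intro b s bi bk) (isGap-intro b t bl bj)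
      with refl ← trans (CyclicSucc⇒≡next s) (sym (CyclicSucc⇒≡next t)) = ⊥-elim (⟶-asym i⟶k j⟶l)
    conclude (inj₂ s) (inj₁ t) with refl ← unique (isGap-intro b s bk bi) (isGap-intro b t bj bl)
      with refl ← trans (CyclicSucc⇒≡next s) (sym (CyclicSucc⇒≡next t)) = ⊥-elim (⟶-asym i⟶k j⟶l)

-- Reversal turns sinks into sources and exchanges in-degrees with out-degrees, so it preserves
-- alternation.
sinks⇒alternating : ∀ {G} (O : Orientation G) (P : Graph.Vertex G → Bool) → Sources (reverse O) P →
                    ∀ {m} (C : Cycle G (suc m)) → gaps (P ∘ Cycle.at C) ≤ 1 → Alternating O C
sinks⇒alternating O P snk C ≤1 i j ti tj = sources⇒alternating (reverse O) P snk C ≤1 i j (swap ti) (swap tj)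

-- Counting gaps in Schrijver graphs

∣∣≡sum : ∀ {n} (A : Subset n) → ∣ A ∣ ≡ sum (χ ∘ lookup A)
∣∣≡sum []          = refl
∣∣≡sum (true  ∷ A) = cong suc (∣∣≡sum A)
∣∣≡sum (false ∷ A) = ∣∣≡sum A

module _ {n k : ℕ} .{{_ : NonZero k}} where

  setOf : Graph.Vertex (SG n k) → Subset n
  setOf v = KSubset.set (InducedVertex.vertex v)

  contains : Fin n → Graph.Vertex (SG n k) → Bool
  contains e v = lookup (setOf v) e

  setOf-injective : Injective _≡_ _≡_ setOf
  setOf-injective refl = refl

  ∣setOf∣ : ∀ v → ∣ setOf v ∣ ≡ k
  ∣setOf∣ ((A ! ∣A∣≡k) ! _) = recompute (∣ A ∣ ℕₚ.≟ k) ∣A∣≡k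

  consecutive⇒⊥ : ∀ {i j} → CyclicSucc i j → ∀ v → contains i v ≡ true → contains j v ≡ true → ⊥
  consecutive⇒⊥ {i} {j} s (_ ! stable) i∈v j∈v =
    ⊥-elim-irr (stable i j s (lookup⇒[]= i _ i∈v , lookup⇒[]= j _ j∈v))

  ~⇒disjoint : ∀ {u v} → Graph._~_ (SG n k) u v → ∀ e → contains e u ≡ true → contains e v ≡ true → ⊥
  ~⇒disjoint u~v e p q = u~v (e , x∈p∩q⁺ (lookup⇒[]= e _ p , lookup⇒[]= e _ q))

  module _ {m} (C : Cycle (SG n k) (suc m)) where
    open Cycle C

    gapsAt : Fin n → ℕ
    gapsAt e = gaps (contains e ∘ at)

    noConsecutive : ∀ e → NoConsecutive (contains e ∘ at)
    noConsecutive e i = ~⇒disjoint {at i} {at (next i)} (edge (CyclicSucc-next i)) e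

    gapsOdd : Odd (suc m) → ∀ e → Odd (gapsAt e)
    gapsOdd odd e = gaps-odd (contains e ∘ at) (noConsecutive e) odd

    -- Adds up `gaps+2*ones≡length` over all elements; the ones are counted set by set instead, each
    -- set contributing `k`.
    ∑gapsAt : sum gapsAt + 2 * (suc m * k) ≡ n * suc m
    ∑gapsAt = begin
      sum gapsAt + 2 * (suc m * k)
        ≡⟨ cong (λ s → sum gapsAt + 2 * s) (sum-const (suc m) k) ⟨
      sum gapsAt + 2 * sum {suc m} (λ _ → k)
        ≡⟨ cong (λ s → sum gapsAt + 2 * s) (sum-cong-≗ (λ i → trans (sym (∣∣≡sum (setOf (at i)))) (∣setOf∣ (at i)))) ⟨
      sum gapsAt + 2 * sum (λ i → sum (λ e → χ (contains e (at i))))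
        ≡⟨ cong (λ s → sum gapsAt + 2 * s) (∑-comm (λ i e → χ (contains e (at i)))) ⟩
      sum gapsAt + 2 * sum ones
        ≡⟨ cong (λ s → sum gapsAt + (sum ones + s)) (ℕₚ.+-identityʳ _) ⟩
      sum gapsAt + (sum ones + sum ones)
        ≡⟨ cong (sum gapsAt +_) (∑-distrib-+ ones ones) ⟨
      sum gapsAt + sum (λ e → ones e + ones e)
        ≡⟨ ∑-distrib-+ gapsAt _ ⟨
      sum (λ e → gapsAt e + (ones e + ones e))
        ≡⟨ sum-cong-≗ (λ e → trans (cong (λ s → gapsAt e + (ones e + s)) (sym (ℕₚ.+-identityʳ _)))
                                   (gaps+2*ones≡length (contains e ∘ at) (noConsecutive e))) ⟩
      sum {n} (λ _ → suc m)
        ≡⟨ sum-const n (suc m) ⟩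
      n * suc m ∎
      where
      open ≡-Reasoning
      ones : Fin n → ℕ
      ones e = sum (λ i → χ (contains e (at i)))

-- The orientation

-- As `false` lies below `true`, only the first bit needs negating: containing 0 should make a set
-- small, containing 1 should make it large.
flipHead : ∀ {n} → Vec Bool (suc n) → Vec Bool (suc n)
flipHead (b ∷ bs) = not b ∷ bs

flipHead-injective : ∀ {n} {A B : Vec Bool (suc n)} → flipHead A ≡ flipHead B → A ≡ B
flipHead-injective {A = false ∷ _} {false ∷ _} refl = refl
flipHead-injective {A = true ∷ _}  {true ∷ _}  refl = refl

-- Sets containing 0 come first and sets containing 1 come last, a stable
-- set never containing both.
_≺_ : ∀ {n} → Subset (suc n) → Subset (suc n) → Set
A ≺ B = Lex.Lex-< _≡_ Bool._<_ (flipHead A) (flipHead B)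

module _ {n k : ℕ} .{{_ : NonZero k}} where
  open Graph (SG (2 + n) k)

  orientation : Orientation (SG (2 + n) k)
  orientation = record
    { _⟶_     = λ u v → u ~ v × setOf u ≺ setOf v
    ; ⟶-edge  = proj₁
    ; ⟶-total = λ {u} {v} → total u v
    ; ⟶-asym  = λ (_ , u≺v) (_ , v≺u) → Lex.<-asym sym (subst _ , subst _) Boolₚ.<-asym u≺v v≺u
    }
    where
    total : ∀ u v → u ~ v → (u ~ v × setOf u ≺ setOf v) ⊎ (v ~ u × setOf v ≺ setOf u)
    total u v u~v with Lex.<-cmp sym Boolₚ.<-cmp (flipHead (setOf u)) (flipHead (setOf v))
    ... | tri< u≺v _ _ = inj₁ (u~v , u≺v)
    ... | tri> _ _ v≺u = inj₂ (~-sym {u} {v} u~v , v≺u)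
    ... | tri≈ _ u≋v _ = ⊥-elim (~-irrefl u (subst (u ~_) (sym u≡v) u~v))
      where u≡v = setOf-injective {x = u} {v} (flipHead-injective (Pointwise-≡⇒≡ u≋v))

  0-sources : Sources orientation (contains zero)
  0-sources {u} {v} u~v 0∈u = u~v , first (setOf u) (setOf v) 0∈u (~⇒disjoint {u = u} {v} u~v zero 0∈u)
    where
    first : (A B : Subset (2 + n)) → lookup A zero ≡ true → ¬ (lookup B zero ≡ true) → A ≺ B
    first (true ∷ _) (false ∷ _) _ _   = Lex.this Bool.f<t refl
    first (true ∷ _) (true  ∷ _) _ 0∉B = ⊥-elim (0∉B refl)

  -- Stability keeps 0 out of a set containing 1, so its flipped first bit is the largest possible.
  -- A tie there is decided by the next bit, since a disjoint set lacks 1.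
  1-sinks : Sources (reverse orientation) (contains (suc zero))
  1-sinks {u} {v} u~v 1∈u =
    ~-sym {u} {v} u~v , last (setOf u) (setOf v) 1∈u (~⇒disjoint {u = u} {v} u~v (suc zero) 1∈u)
                                      (λ 0∈u → consecutive⇒⊥ (step refl) u 0∈u 1∈u)
    where
    last : (A B : Subset (2 + n)) → lookup A (suc zero) ≡ true → ¬ (lookup B (suc zero) ≡ true) →
           ¬ (lookup A zero ≡ true) → B ≺ A
    last (true  ∷ _)        _                   _ _   0∉A = ⊥-elim (0∉A refl)
    last (false ∷ true ∷ _) (_     ∷ true  ∷ _) _ 1∉B _   = ⊥-elim (1∉B refl)
    last (false ∷ true ∷ _) (true  ∷ false ∷ _) _ _   _   = Lex.this Bool.f<t refl
    last (false ∷ true ∷ _) (false ∷ false ∷ _) _ _   _   = Lex.next refl (Lex.this Bool.f<t refl)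

  fewGaps⇒alternating : ∀ {m} (C : Cycle (SG (2 + n) k) (suc m)) → Odd (suc m) →
                        sum (gapsAt C) ≤ 5 + n → Alternating orientation C
  fewGaps⇒alternating C odd few
    with odd⇒≤1⊎≥3 _ (gapsOdd C odd zero) | odd⇒≤1⊎≥3 _ (gapsOdd C odd (suc zero))
  ... | inj₁ ≤1  | _        = sources⇒alternating orientation (contains zero) (λ {u} {v} → 0-sources {u} {v}) C ≤1
  ... | inj₂ _   | inj₁ ≤1  = sinks⇒alternating orientation (contains (suc zero)) (λ {u} {v} → 1-sinks {u} {v}) C ≤1
  ... | inj₂ 3≤₀ | inj₂ 3≤₁ =
    -- Three gaps for each of 0 and 1 and at least one for each of the other `n` elements make
    -- `6 + n`.
    ⊥-elim (ℕₚ.<⇒≱ (ℕₚ.+-mono-≤ 3≤₀ (ℕₚ.+-mono-≤ 3≤₁ (n≤sum _ λ e → odd⇒≥1 (gapsOdd C odd (suc (suc e)))))) few)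

-- Odd cycles of Schrijver graphs

odd? : ℕ → Bool
odd? zero    = false
odd? (suc n) = not (odd? n)

odd?-absurd : ∀ n → odd? n ≡ true → odd? (suc n) ≡ true → ⊥
odd?-absurd n p q rewrite p with () ← q

odd?-*2 : ∀ b → odd? (b * 2) ≡ false
odd?-*2 zero    = refl
odd?-*2 (suc b) rewrite odd?-*2 b = refl

-- The stable set {y + 1, y + 3, …} of size b in the cyclic order of length
-- 2b + 1: going around the cycle, the parity changes when passing 0.
word : ℕ → ℕ → Bool
word zero    e       = odd? e
word (suc y) zero    = odd? y
word (suc y) (suc e) = word y e

word-disjoint : ∀ y e → word y e ≡ true → word (suc y) e ≡ true → ⊥
word-disjoint zero    (suc e) p q = odd?-absurd e q p
word-disjoint (suc y) zero    p q = odd?-absurd y p q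
word-disjoint (suc y) (suc e) p q = word-disjoint y e p q

word-stable : ∀ y e → word y e ≡ true → word y (suc e) ≡ true → ⊥
word-stable zero          e       p q = odd?-absurd e p q
word-stable (suc (suc y)) zero    p q = odd?-absurd y q p
word-stable (suc y)       (suc e) p q = word-stable y e p q

-- With `word-last`, the parity of the index decides which end of the block may be occupied. This
-- gives stability across 0, and also across the junctions of two blocks whose indices have equal
-- parity.
word-first : ∀ y → word y 0 ≡ true → odd? y ≡ false
word-first (suc y) p rewrite p = refl

-- The bound admits the index 2b + 1, one past a full turn, because `bounce` reaches it. At 2b + 2
-- the claim fails.
word-last : ∀ b y → y ≤ suc (b * 2) → word y (b * 2) ≡ true → odd? y ≡ true
word-last b       zero          _               p with () ← trans (sym p) (odd?-*2 b)
word-last b       (suc zero)    _               p = refl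
word-last zero    (suc (suc y)) (s≤s ())        p
word-last (suc b) (suc (suc y)) (s≤s (s≤s y≤)) p = trans (Boolₚ.not-involutive _) (word-last b y y≤ p)

word-≤ : ∀ y e → e ≤ y → word y e ≡ true → odd? e ≡ odd? y
word-≤ (suc y) zero    _         p rewrite p = refl
word-≤ (suc y) (suc e) (s≤s e≤y) p = cong not (word-≤ y e e≤y p)

-- Up to position 2b, the last word occupies even positions only, and `word 0` odd ones only.
word-closing : ∀ b e → e ≤ b * 2 → word (b * 2) e ≡ true → word 0 e ≡ true → ⊥
word-closing b e e≤ p q with () ← trans (sym q) (trans (word-≤ (b * 2) e e≤ p) (odd?-*2 b))

word-+ˡ : ∀ y e → word y (y + e) ≡ odd? e
word-+ˡ zero    e = refl
word-+ˡ (suc y) e = word-+ˡ y e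

word-+ : ∀ y z e → word (y + z) (y + e) ≡ word z e
word-+ zero    z e = refl
word-+ (suc y) z e = word-+ y z e

-- Every word is `false` at the position equal to its index. Agreement at both indices would
-- therefore make both `z` and `suc z` even.
word-distinct : ∀ y z → word y y ≡ word (y + suc z) y → word y (y + suc z) ≡ word (y + suc z) (y + suc z) → ⊥
word-distinct y z p q = Boolₚ.not-¬ (sym odd-z) (sym ¬odd-z)
  where
  open ≡-Reasoning
  odd-z : odd? z ≡ false
  odd-z = begin
    odd? z                     ≡⟨ word-+ y (suc z) 0 ⟨
    word (y + suc z) (y + 0)   ≡⟨ cong (word (y + suc z)) (ℕₚ.+-identityʳ y) ⟩
    word (y + suc z) y         ≡⟨ p ⟨
    word y y                   ≡⟨ cong (word y) (ℕₚ.+-identityʳ y) ⟨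
    word y (y + 0)             ≡⟨ word-+ˡ y 0 ⟩
    false                      ∎
  ¬odd-z : not (odd? z) ≡ false
  ¬odd-z = begin
    odd? (suc z)                      ≡⟨ word-+ˡ y (suc z) ⟨
    word y (y + suc z)                ≡⟨ q ⟩
    word (y + suc z) (y + suc z)      ≡⟨ word-+ y (suc z) (suc z) ⟩
    word z z                          ≡⟨ cong (word z) (ℕₚ.+-identityʳ z) ⟨
    word z (z + 0)                    ≡⟨ word-+ˡ z 0 ⟩
    false                             ∎

-- Subsets and cycles from characteristic functions

subsetOf : ∀ n → (ℕ → Bool) → Subset n
subsetOf zero    f = []
subsetOf (suc n) f = f 0 ∷ subsetOf n (f ∘ suc)

lookup-subsetOf : ∀ {n} f (i : Fin n) → lookup (subsetOf n f) i ≡ f (toℕ i)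
lookup-subsetOf f zero    = refl
lookup-subsetOf f (suc i) = lookup-subsetOf (f ∘ suc) i

subsetOf-cong : ∀ n {f g} → (∀ e → f e ≡ g e) → subsetOf n f ≡ subsetOf n g
subsetOf-cong zero    f≗g = refl
subsetOf-cong (suc n) f≗g = cong₂ _∷_ (f≗g 0) (subsetOf-cong n (f≗g ∘ suc))

∣odd?-periodic∣ : ∀ n → ∣ subsetOf n (λ e → odd? (suc (suc e))) ∣ ≡ ∣ subsetOf n odd? ∣
∣odd?-periodic∣ n = cong ∣_∣ (subsetOf-cong n {λ e → odd? (suc (suc e))} λ e → Boolₚ.not-involutive (odd? e))

-- Induction removes two adjacent entries holding exactly one element: the first two in general, the
-- second and third for index 1.
∣word∣ : ∀ b y → y ≤ suc (b * 2) → ∣ subsetOf (suc (b * 2)) (word y) ∣ ≡ b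
∣word∣ zero    zero          _ = refl
∣word∣ (suc b) zero          _ = cong suc (trans (∣odd?-periodic∣ (suc (b * 2))) (∣word∣ b zero z≤n))
∣word∣ zero    (suc zero)    _ = refl
∣word∣ (suc b) (suc zero)    _ = cong suc (trans (∣odd?-periodic∣ (b * 2)) (∣word∣ b (suc zero) (s≤s z≤n)))
∣word∣ zero    (suc (suc y)) (s≤s ())
∣word∣ (suc b) (suc (suc y)) (s≤s (s≤s y≤)) with odd? y
... | false = cong suc (∣word∣ b y y≤)
... | true  = cong suc (∣word∣ b y y≤)

record CyclicallyStable (n : ℕ) (f : ℕ → Bool) : Set where
  field
    inner    : ∀ e → suc e < n → f e ≡ true → f (suc e) ≡ true → ⊥
    boundary : ∀ e → suc e ≡ n → f e ≡ true → f 0 ≡ true → ⊥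

∈subsetOf⇒ : ∀ {n f} (i : Fin n) → i ∈ subsetOf n f → f (toℕ i) ≡ true
∈subsetOf⇒ {f = f} i i∈ = trans (sym (lookup-subsetOf f i)) ([]=⇒lookup i∈)

subsetOf-stable : ∀ {n f} → CyclicallyStable n f → Stable (subsetOf n f)
subsetOf-stable {n} {f} st i j s (i∈ , j∈) = absurd s (∈subsetOf⇒ i i∈) (∈subsetOf⇒ j j∈)
  where
  open CyclicallyStable st
  absurd : CyclicSucc i j → f (toℕ i) ≡ true → f (toℕ j) ≡ true → ⊥
  absurd (step p)   fi fj = inner (toℕ i) (subst (_< n) p (Finₚ.toℕ<n j)) fi (subst (λ e → f e ≡ true) p fj)
  absurd (wrap p q) fi fj = boundary (toℕ i) p fi (subst (λ e → f e ≡ true) q fj)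

subsetOf-disjoint : ∀ {n f g} → (∀ e → e < n → f e ≡ true → g e ≡ true → ⊥) → Empty (subsetOf n f ∩ subsetOf n g)
subsetOf-disjoint dis (i , i∈) with (i∈f , i∈g) ← x∈p∩q⁻ _ _ i∈ =
  dis (toℕ i) (Finₚ.toℕ<n i) (∈subsetOf⇒ i i∈f) (∈subsetOf⇒ i i∈g)

subsetOf-injective : ∀ {n f g} → subsetOf n f ≡ subsetOf n g → ∀ e → e < n → f e ≡ g e
subsetOf-injective {suc n} f≡g zero    _         = proj₁ (∷-injective f≡g)
subsetOf-injective {suc n} f≡g (suc e) (s≤s e<n) = subsetOf-injective (proj₂ (∷-injective f≡g)) e e<n

-- The closing edge is a separate hypothesis because `f` need not be periodic in its index.
cycleOf : ∀ {n k l} .{{_ : NonZero k}} (f : ℕ → ℕ → Bool) → 2 ≤ l →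
          (∀ y → y ≤ l → ∣ subsetOf n (f y) ∣ ≡ k) →
          (∀ y → y ≤ l → CyclicallyStable n (f y)) →
          (∀ y e → e < n → f y e ≡ true → f (suc y) e ≡ true → ⊥) →
          (∀ e → e < n → f l e ≡ true → f 0 e ≡ true → ⊥) →
          (∀ y z → y + suc z ≤ l → (∀ e → e < n → f y e ≡ f (y + suc z) e) → ⊥) →
          Cycle (SG n k) (suc l)
cycleOf {n} {k} {l} f 2≤l size stable disjoint closing distinct = record
  { length≥3  = s≤s 2≤l
  ; at        = at
  ; injective = λ {i} {j} → injective i j
  ; edge      = λ {i} {j} → edge i j
  }
  where
  at : Fin (suc l) → Graph.Vertex (SG n k)
  at i = (subsetOf n (f (toℕ i)) ! size _ (Finₚ.toℕ≤pred[n] i)) ! subsetOf-stable (stable _ (Finₚ.toℕ≤pred[n] i))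

  increasing : ∀ i j → toℕ i < toℕ j → at i ≡ at j → ⊥
  increasing i j i<j eq = distinct (toℕ i) z (subst (_≤ l) (sym j≡) (Finₚ.toℕ≤pred[n] j))
    λ e e<n → trans (subsetOf-injective (cong setOf eq) e e<n) (cong (λ y → f y e) (sym j≡))
    where
    z = toℕ j ∸ suc (toℕ i)
    j≡ : toℕ i + suc z ≡ toℕ j
    j≡ = trans (ℕₚ.+-suc _ z) (ℕₚ.m+[n∸m]≡n i<j)

  injective : ∀ i j → at i ≡ at j → i ≡ j
  injective i j eq with ℕₚ.<-cmp (toℕ i) (toℕ j)
  ... | tri< i<j _ _ = ⊥-elim (increasing i j i<j eq)
  ... | tri≈ _ i≡j _ = Finₚ.toℕ-injective i≡j
  ... | tri> _ _ j<i = ⊥-elim (increasing j i j<i (sym eq))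

  edge : ∀ i j → CyclicSucc i j → Empty (setOf (at i) ∩ setOf (at j))
  edge i j (step p)   rewrite p = subsetOf-disjoint (disjoint (toℕ i))
  edge i j (wrap p q) rewrite q | ℕₚ.suc-injective p = subsetOf-disjoint closing

wordCycle : ∀ k .{{_ : NonZero k}} → Cycle (SG (suc (k * 2)) k) (suc (k * 2))
wordCycle k@(suc k′) = cycleOf word (s≤s (s≤s z≤n))
  (λ y y≤ → ∣word∣ k y (ℕₚ.m≤n⇒m≤1+n y≤))
  (λ y y≤ → record
    { inner    = λ e _ → word-stable y e
    ; boundary = λ { e refl p q → case trans (sym (word-last k y (ℕₚ.m≤n⇒m≤1+n y≤) p)) (word-first y q) of λ () } })
  (λ y e _ → word-disjoint y e)
  (λ e e< → word-closing k e (ℕₚ.≤-pred e<))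
  (λ y z z≤ eq → word-distinct y z (eq y (s≤s (ℕₚ.m+n≤o⇒m≤o y z≤))) (eq (y + suc z) (s≤s z≤)))

-- Concatenating two families of stable sets

join : ℕ → (ℕ → Bool) → (ℕ → Bool) → ℕ → Bool
join zero    f g e       = g e
join (suc c) f g zero    = f 0
join (suc c) f g (suc e) = join c (f ∘ suc) g e

join-< : ∀ {c e} f g → e < c → join c f g e ≡ f e
join-< {e = zero}  f g (s≤s _)   = refl
join-< {e = suc e} f g (s≤s e<c) = join-< (f ∘ suc) g e<c

join-+ : ∀ c f g e → join c f g (c + e) ≡ g e
join-+ zero    f g e = refl
join-+ (suc c) f g e = join-+ c (f ∘ suc) g e

∣join∣ : ∀ c d f g → ∣ subsetOf (c + d) (join c f g) ∣ ≡ ∣ subsetOf c f ∣ + ∣ subsetOf d g ∣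
∣join∣ zero    d f g = refl
∣join∣ (suc c) d f g with f 0
... | true  = cong suc (∣join∣ c d (f ∘ suc) g)
... | false = ∣join∣ c d (f ∘ suc) g

data Split (c : ℕ) : ℕ → Set where
  left  : ∀ {e} → e < c → Split c e
  right : ∀ e → Split c (c + e)

split : ∀ c e → Split c e
split c e with ℕₚ.<-≤-connex e c
... | inj₁ e<c = left e<c
... | inj₂ c≤e = subst (Split c) (ℕₚ.m+[n∸m]≡n c≤e) (right (e ∸ c))

join-disjoint : ∀ c {d} f g f′ g′ → (∀ e → e < c → f e ≡ true → f′ e ≡ true → ⊥) →
                (∀ e → e < d → g e ≡ true → g′ e ≡ true → ⊥) →
                ∀ e → e < c + d → join c f g e ≡ true → join c f′ g′ e ≡ true → ⊥
join-disjoint c f g f′ g′ f#f′ g#g′ e e< p q with split c e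
... | left e<c = f#f′ e e<c (trans (sym (join-< f g e<c)) p) (trans (sym (join-< f′ g′ e<c)) q)
... | right e′ = g#g′ e′ (ℕₚ.+-cancelˡ-< c _ _ e<)
                   (trans (sym (join-+ c f g e′)) p) (trans (sym (join-+ c f′ g′ e′)) q)

-- The blocks meet twice in the cyclic order: at positions `c` and `suc c`, and again across 0. The
-- last two hypotheses guard these junctions.
join-stable : ∀ c {d} f g → (∀ e → f e ≡ true → f (suc e) ≡ true → ⊥) → (∀ e → g e ≡ true → g (suc e) ≡ true → ⊥) →
              (f c ≡ true → g 0 ≡ true → ⊥) → (g d ≡ true → f 0 ≡ true → ⊥) →
              CyclicallyStable (suc c + suc d) (join (suc c) f g)
join-stable c {d} f g f-stable g-stable f-g g-f = record { inner = inner ; boundary = boundary }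
  where
  fg = join (suc c) f g

  atLeft : ∀ {e} → e < suc c → fg e ≡ true → f e ≡ true
  atLeft e< = trans (sym (join-< f g e<))

  atRight : ∀ {e} e′ → e ≡ suc c + e′ → fg e ≡ true → g e′ ≡ true
  atRight e′ refl = trans (sym (join-+ (suc c) f g e′))

  inner : ∀ e → suc e < suc c + suc d → fg e ≡ true → fg (suc e) ≡ true → ⊥
  inner e _ p q with split (suc c) e
  ... | right e′ = g-stable e′ (atRight e′ refl p) (atRight (suc e′) (sym (ℕₚ.+-suc (suc c) e′)) q)
  ... | left e<c with ℕₚ.m≤n⇒m<n∨m≡n e<c
  ... | inj₁ 1+e<c = f-stable e (atLeft e<c p) (atLeft 1+e<c q)
  ... | inj₂ refl  = f-g (atLeft e<c p) (atRight 0 (sym (ℕₚ.+-identityʳ (suc c))) q)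

  boundary : ∀ e → suc e ≡ suc c + suc d → fg e ≡ true → fg 0 ≡ true → ⊥
  boundary e e≡ p q = g-f (atRight d (trans (ℕₚ.suc-injective e≡) (ℕₚ.+-suc c d)) p) q

-- 0, 1, …, 2a, 2a + 1, 2a, 2a + 1, 2a, …
bounce : ℕ → ℕ → ℕ
bounce a       zero          = 0
bounce a       (suc zero)    = 1
bounce zero    (suc (suc y)) = bounce zero y
bounce (suc a) (suc (suc y)) = 2 + bounce a y

bounce-≤ : ∀ a y → bounce a y ≤ suc (a * 2)
bounce-≤ a       zero          = z≤n
bounce-≤ a       (suc zero)    = s≤s z≤n
bounce-≤ zero    (suc (suc y)) = bounce-≤ zero y
bounce-≤ (suc a) (suc (suc y)) = s≤s (s≤s (bounce-≤ a y))

-- Equal parity of the two indices is what keeps the junctions of the joined sets stable.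
odd?-bounce : ∀ a y → odd? (bounce a y) ≡ odd? y
odd?-bounce a       zero          = refl
odd?-bounce a       (suc zero)    = refl
odd?-bounce zero    (suc (suc y)) = trans (odd?-bounce zero y) (sym (Boolₚ.not-involutive _))
odd?-bounce (suc a) (suc (suc y)) = cong (not ∘ not) (odd?-bounce a y)

-- When the longer block completes its turn, the shorter one is also at its last word, so both close
-- up together.
bounce-*2 : ∀ {a b} → a ≤ b → bounce a (b * 2) ≡ a * 2
bounce-*2 {b = zero}  z≤n       = refl
bounce-*2 {b = suc b} z≤n       = bounce-*2 {b = b} z≤n
bounce-*2             (s≤s a≤b) = cong (2 +_) (bounce-*2 a≤b)

bounce-suc : ∀ a y → bounce a (suc y) ≡ suc (bounce a y) ⊎ bounce a y ≡ suc (bounce a (suc y))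
bounce-suc a       zero          = inj₁ refl
bounce-suc zero    (suc zero)    = inj₂ refl
bounce-suc (suc a) (suc zero)    = inj₁ refl
bounce-suc zero    (suc (suc y)) = bounce-suc zero y
bounce-suc (suc a) (suc (suc y)) with bounce-suc a y
... | inj₁ p = inj₁ (cong (2 +_) p)
... | inj₂ p = inj₂ (cong (2 +_) p)

bounce-disjoint : ∀ a y e → word (bounce a y) e ≡ true → word (bounce a (suc y)) e ≡ true → ⊥
bounce-disjoint a y e p q with bounce-suc a y
... | inj₁ up   rewrite up   = word-disjoint (bounce a y) e p q
... | inj₂ down rewrite down = word-disjoint (bounce a (suc y)) e q p

-- The second block runs once through its 2b + 1 words, which alone makes the vertices distinct. The
-- first passes through its 2a + 1 words and spends the remaining steps going back and forth.
joinedCycle : ∀ {a b} .{{_ : NonZero (a + b)}} → 1 ≤ b → a ≤ b →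
              Cycle (SG (suc (a * 2) + suc (b * 2)) (a + b)) (suc (b * 2))
joinedCycle {a} {b} 1≤b a≤b = cycleOf (λ y → join c (f y) (word y)) (ℕₚ.*-monoˡ-≤ 2 1≤b)
  (λ y y≤ → trans (∣join∣ c d (f y) (word y))
                  (cong₂ _+_ (∣word∣ a (bounce a y) (bounce-≤ a y)) (∣word∣ b y (ℕₚ.m≤n⇒m≤1+n y≤))))
  (λ y y≤ → join-stable (a * 2) (f y) (word y) (word-stable (bounce a y)) (word-stable y)
    (λ p q → case trans (sym (word-last a (bounce a y) (bounce-≤ a y) p)) (trans (odd?-bounce a y) (word-first y q)) of λ ())
    (λ p q → case trans (sym (word-last b y (ℕₚ.m≤n⇒m≤1+n y≤) p)) (trans (sym (odd?-bounce a y)) (word-first (bounce a y) q)) of λ ()))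
  (λ y → join-disjoint c (f y) (word y) (f (suc y)) (word (suc y))
    (λ e _ → bounce-disjoint a y e)
    (λ e _ → word-disjoint y e))
  (join-disjoint c (f (b * 2)) (word (b * 2)) (f 0) (word 0)
    (λ e e< p → word-closing a e (ℕₚ.≤-pred e<) (subst (λ x → word x e ≡ true) (bounce-*2 a≤b) p))
    (λ e e< → word-closing b e (ℕₚ.≤-pred e<)))
  (λ y z z≤ eq → let eqʳ = onRight y (y + suc z) eq in
    word-distinct y z (eqʳ y (s≤s (ℕₚ.m+n≤o⇒m≤o y z≤))) (eqʳ (y + suc z) (s≤s z≤)))
  where
  c = suc (a * 2)
  d = suc (b * 2)

  f : ℕ → ℕ → Bool
  f y = word (bounce a y)

  onRight : ∀ y z → (∀ e → e < c + d → join c (f y) (word y) e ≡ join c (f z) (word z) e) →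
            ∀ e → e < d → word y e ≡ word z e
  onRight y z eq e e< =
    trans (sym (join-+ c (f y) (word y) e)) (trans (eq (c + e) (ℕₚ.+-monoʳ-< c e<)) (join-+ c (f z) (word z) e))

-- Length of a shortest odd cycle and conclusion

halve : ∀ k → ∃[ a ] ∃[ b ] (k ≡ a + b × a ≤ b × b ≤ suc a)
halve zero    = 0 , 0 , refl , z≤n , z≤n
halve (suc k) with (a , b , refl , a≤b , b≤1+a) ← halve k =
  b , suc a , trans (cong suc (ℕₚ.+-comm a b)) (sym (ℕₚ.+-suc b a)) , b≤1+a , s≤s a≤b

odd-1+*2 : ∀ b → Odd (suc (b * 2))
odd-1+*2 b = [m+kn]%n≡m%n 1 b 2

-- For ground sets of size n = r + 2k, the left side is the total number of gaps by `∑gapsAt`, and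
-- the right side n + 3 is the most that `fewGaps⇒alternating` tolerates.
shortestLength : ∀ r k .{{_ : NonZero k}} → r ≤ 2 → ∀ m →
                 (∀ m′ → Odd m′ → Cycle (SG (r + 2 * k) k) m′ → m ≤ m′) → r * m ≤ 3 + (r + 2 * k)
shortestLength 0 k _ m shortest = z≤n
shortestLength 1 k _ m shortest = begin
  1 * m             ≡⟨ ℕₚ.*-identityˡ m ⟩
  m                 ≤⟨ shortest _ (odd-1+*2 k) (subst (λ n → Cycle (SG n k) (suc (k * 2))) (cong suc (ℕₚ.*-comm k 2)) (wordCycle k)) ⟩
  1 + k * 2         ≡⟨ cong suc (ℕₚ.*-comm k 2) ⟩
  1 + 2 * k         ≤⟨ ℕₚ.m≤n+m _ 3 ⟩
  3 + (1 + 2 * k)   ∎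
  where open ℕₚ.≤-Reasoning
-- The cycle has length 2b + 1, that is k + 1 or k + 2 according to the parity of k. Twice this is
-- at most n + 2.
shortestLength 2 k _ m shortest with (a , b , refl , a≤b , b≤1+a) ← halve k = begin
  2 * m                       ≤⟨ ℕₚ.*-monoʳ-≤ 2 (shortest _ (odd-1+*2 b) (subst (λ n → Cycle (SG n (a + b)) (suc (b * 2))) (ground a b) (joinedCycle (positive a≤b (>-nonZero⁻¹ (a + b))) a≤b))) ⟩
  2 * suc (b * 2)             ≡⟨ doubled b ⟩
  2 + 2 * b + 2 * b           ≤⟨ ℕₚ.+-monoʳ-≤ (2 + 2 * b) (ℕₚ.*-monoʳ-≤ 2 b≤1+a) ⟩
  2 + 2 * b + 2 * suc a       ≤⟨ ℕₚ.n≤1+n _ ⟩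
  3 + 2 * b + 2 * suc a       ≡⟨ rearranged a b ⟩
  3 + (2 + 2 * (a + b))       ∎
  where
  open ℕₚ.≤-Reasoning
  ground : ∀ a b → suc (a * 2) + suc (b * 2) ≡ 2 + 2 * (a + b)
  ground = solve-∀
  doubled : ∀ b → 2 * suc (b * 2) ≡ 2 + 2 * b + 2 * b
  doubled = solve-∀
  rearranged : ∀ a b → 3 + 2 * b + 2 * suc a ≡ 3 + (2 + 2 * (a + b))
  rearranged = solve-∀
  positive : ∀ {a b} → a ≤ b → 0 < a + b → 1 ≤ b
  positive {b = zero}  z≤n ()
  positive {b = suc b} _   _ = s≤s z≤n
shortestLength (suc (suc (suc r))) k (s≤s (s≤s ()))

mainTheorem15 : (n k : ℕ) .{{_ : NonZero k}} → 2 * k ≤ n → n ≤ 2 * k + 2 →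
    Σ[ O ∈ Orientation (SG n k) ] (∀ {m} (C : Cycle (SG n k) m) → ShortestOdd C → Alternating O C)
-- Since k is positive, n is at least 2, so that the elements 0 and 1 exist.
mainTheorem15 n k 2k≤n n≤2k+2 with ℕₚ.≤-trans (ℕₚ.*-monoʳ-≤ 2 (>-nonZero⁻¹ k)) 2k≤n
mainTheorem15 n@(suc (suc n′)) k 2k≤n n≤2k+2 | s≤s (s≤s _) = orientation , alternating
  where
  r = n ∸ 2 * k

  n≡r+2k : n ≡ r + 2 * k
  n≡r+2k = sym (ℕₚ.m∸n+n≡m 2k≤n)

  r≤2 : r ≤ 2
  r≤2 = ℕₚ.m≤n+o⇒m∸n≤o n (2 * k) n≤2k+2

  alternating : ∀ {m} (C : Cycle (SG n k) m) → ShortestOdd C → Alternating orientation C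
  alternating {zero}  C (() , _)
  alternating {suc m} C (odd , shortest) = fewGaps⇒alternating C odd (begin
    -- Cancelling the elements of the sets, counted twice, leaves `r * suc m` gaps. The final
    -- `3 + n` is `5 + n′`, as `n` is `2 + n′`.
    sum (gapsAt C)    ≡⟨ ℕₚ.+-cancelʳ-≡ (2 * (suc m * k)) _ _ (trans (∑gapsAt C) total) ⟩
    r * suc m         ≤⟨ shortestLength r k r≤2 (suc m) (subst (λ n → ∀ m′ → Odd m′ → Cycle (SG n k) m′ → suc m ≤ m′) n≡r+2k shortest) ⟩
    3 + (r + 2 * k)   ≡⟨ cong (3 +_) n≡r+2k ⟨
    3 + n             ∎)
    where
    open ℕₚ.≤-Reasoning
    distribute : ∀ r m k → (r + 2 * k) * m ≡ r * m + 2 * (m * k)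
    distribute = solve-∀
    total : n * suc m ≡ r * suc m + 2 * (suc m * k)
    total = trans (cong (_* suc m) n≡r+2k) (distribute r (suc m) k)
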